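{- Let $\lambda$ be a nonzero real (or complex) number. For every integer $n\ge 0$, $$\beta_{n,\lambda}^{(2)}=(-1)^{n}\sum_{m=0}^{n}\binom{n}{m}\beta_{m,\lambda}\frac{\beta_{n-m,\lambda}(1-\lambda)}{n-m+1}=(-1)^{n}\sum_{m=0}^{n}\binom{n}{m}\beta_{n-m,\lambda}\frac{\beta_{m,\lambda}(1-\lambda)}{m+1}.$$
   Context: All generating functions are formal power series. For nonzero $\lambda$ and any $x$, the degenerate exponential is $e_\lambda^x(t)=(1+\lambda t)^{x/\lambda}=\sum_{n\ge0}\binom{x/\lambda}{n}\lambda^n t^n$ and $e_\lambda(t)=e_\lambda^1(t)$. Carlitz's degenerate Bernoulli polynomials $\beta_{n,\lambda}(x)$ are defined by $\frac{t}{e_{\lambda}(t)-1}e_{\lambda}^{x}(t)=\sum_{n=0}^{\infty}\beta_{n,\lambda}(x)\frac{t^{n}}{n!}$, and $\beta_{n,\lambda}=\beta_{n,\lambda}(0)$. Here $\beta_{n,\lambda}(1-\lambda)$ denotes the value of this polynomial at $x=1-\lambda$. For nonzero $\mu$, put $(1)_{0,\mu}=1$ and $(1)_{n,\mu}=(1-\mu)(1-2\mu)\cdots(1-(n-1)\mu)$ for $n\ge1$ (so $(1)_{1,\mu}=1$). For $k\in\mathbb{Z}$ the degenerate polylogarithm function is $l_{k,\lambda}(x)=\sum_{n=1}^{\infty}\frac{(-\lambda)^{n-1}(1)_{n,1/\lambda}}{(n-1)!\,n^{k}}x^{n}$, and the degenerate poly-Bernoulli numbers $\beta_{n,\lambda}^{(k)}$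 are defined by $$\frac{l_{k,\lambda}(1-e_{\lambda}(-t))}{1-e_{\lambda}(-t)}=\sum_{n=0}^{\infty}\beta_{n,\lambda}^{(k)}\frac{t^{n}}{n!},$$ i.e. by substituting $x=1-e_\lambda(-t)$ (which has zero constant term) into the power series $l_{k,\lambda}(x)/x$. The theorem concerns $k=2$. -}

module Defs where

open import Algebra.Apartness.Bundles using (HeytingField; HeytingCommutativeRing)
open import Algebra.Bundles using (CommutativeRing)
import Algebra.Apartness.Properties.HeytingCommutativeRing as HCRProperties
import Algebra.Properties.Ring as RingProperties
import Algebra.Properties.Semiring.Exp as Exp
import Algebra.Properties.Semiring.Mult as Mult
import Algebra.Properties.Semiring.Sum as Sum
open import Data.Fin.Base using (Fin; toℕ; zero; suc)
open import Data.Integer.Base using (ℤ; +_; -[1+_])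
open import Data.Nat.Base using (ℕ; zero; suc; _∸_; NonZero; _!)
open import Data.Nat.Properties using (_!≢0)
open import Data.Product.Base using (proj₁; proj₂)
open import Data.Vec.Functional as Vector using (Vector)
open import Relation.Binary.PropositionalEquality.Core using (_≡_)
import Relation.Binary.Reasoning.Setoid as SetoidReasoning

module HeytingFieldOps {c ℓ₁ ℓ₂} (K : HeytingField c ℓ₁ ℓ₂) where

  open HeytingField K public
    using (Carrier; _≈_; _#_; _+_; _*_; -_; _-_; 0#; 1#; heytingCommutativeRing)
  open HeytingCommutativeRing heytingCommutativeRing public using (commutativeRing)
  open CommutativeRing commutativeRing public using (semiring; ring)
  open Exp semiring public using (_^_)
  open Mult semiring using () renaming (_×_ to _×ᴷ_)
  open Sum semiring public using (sum⁺-syntax)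

  ι : ℕ → Carrier
  ι n = n ×ᴷ 1#

CharacteristicZero : ∀ {c ℓ₁ ℓ₂} → HeytingField c ℓ₁ ℓ₂ → Set ℓ₂
CharacteristicZero K = ∀ n → .{{NonZero n}} → ι n # 0#
  where open HeytingFieldOps K

module Degenerate
  {c ℓ₁ ℓ₂} (K : HeytingField c ℓ₁ ℓ₂) (char0 : CharacteristicZero K) where

  open HeytingFieldOps K
  open HeytingField K
    using ( setoid; refl; sym; trans; #⇒invertible
          ; +-cong; +-congˡ; +-congʳ; *-cong; *-congˡ; *-congʳ
          ; +-identityʳ; *-identityˡ; *-identityʳ; *-assoc; *-comm; -‿inverseʳ)
  open HCRProperties heytingCommutativeRing using (x-0≈x; 1#0; #-congʳ)
  open RingProperties ring using (-‿distribʳ-*)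

  -- The library only inverts differences x - y of apart elements.
  inv : (x : Carrier) → x # 0# → Carrier
  inv x x#0 = proj₁ (#⇒invertible x#0)

  inv-inverseʳ : ∀ x (x#0 : x # 0#) → x * inv x x#0 ≈ 1#
  inv-inverseʳ x x#0 =
    trans (*-congʳ (sym (x-0≈x x))) (proj₂ (proj₂ (#⇒invertible x#0)))

  inv-inverseˡ : ∀ x (x#0 : x # 0#) → inv x x#0 * x ≈ 1#
  inv-inverseˡ x x#0 = trans (*-comm _ _) (inv-inverseʳ x x#0)

  1/ι : (n : ℕ) → .{{NonZero n}} → Carrier
  1/ι n = inv (ι n) (char0 n)

  1/!_ : ℕ → Carrier
  1/! n = 1/ι (n !) {{n !≢0}}

  -- 1 / n ^ k for an integer exponent k.
  1/⟨_⟩^_ : (n : ℕ) → .{{NonZero n}} → ℤ → Carrier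
  1/⟨ n ⟩^ (+ k)    = (1/ι n) ^ k
  1/⟨ n ⟩^ -[1+ k ] = (ι n) ^ suc k

  -- x (x - μ) (x - 2μ) ⋯ (x - (n - 1) μ)
  falling : Carrier → ℕ → Carrier → Carrier
  falling x zero    μ = 1#
  falling x (suc n) μ = falling x n μ * (x - ι n * μ)

  binomial : Carrier → ℕ → Carrier
  binomial x n = falling x n 1# * 1/! n

  -- The series f stands for ∑ f n tⁿ.
  Series : Set c
  Series = ℕ → Carrier

  1ˢ : Series
  1ˢ zero    = 1#
  1ˢ (suc n) = 0#

  infixl 6 _-ˢ_
  infixl 7 _*ˢ_
  infixr 8 _^ˢ_

  _-ˢ_ : Series → Series → Series
  (f -ˢ g) n = f n - g n

  _*ˢ_ : Series → Series → Series
  (f *ˢ g) n = ∑[ i ≤ n ] (f (toℕ i) * g (n ∸ toℕ i))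

  _^ˢ_ : Series → ℕ → Series
  f ^ˢ zero  = 1ˢ
  f ^ˢ suc m = f *ˢ (f ^ˢ m)

  -- f(-t)
  _[-t] : Series → Series
  (f [-t]) n = (- 1#) ^ n * f n

  -- f(t) / t; the proof argument makes the shift an exact division.
  divideByT : (f : Series) → f 0 ≈ 0# → Series
  divideByT f _ n = f (suc n)

  -- f(g(t)).  As g has zero constant term, g(t)ᵐ contributes nothing to the
  -- coefficient of tⁿ for m > n, so the sum may stop at m = n.
  substitute : (f g : Series) → g 0 ≈ 0# → Series
  substitute f g _ n = ∑[ m ≤ n ] (f (toℕ m) * (g ^ˢ toℕ m) n)

  module _ (f : Series) (f₀#0 : f 0 # 0#) where

    -- The entry at i is the coefficient of tⁿ⁻ⁱ in 1 / f(t).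
    recipCoeffs : (n : ℕ) → Vector Carrier (suc n)
    recipCoeffs zero    = λ _ → inv (f 0) f₀#0
    recipCoeffs (suc n) =
      (- (inv (f 0) f₀#0 * (∑[ i ≤ n ] (f (suc (toℕ i)) * recipCoeffs n i))))
        Vector.∷ recipCoeffs n

    recip : Series
    recip n = recipCoeffs n zero

    recipCoeffs-recip : ∀ n (i : Fin (suc n)) → recipCoeffs n i ≡ recip (n ∸ toℕ i)
    recipCoeffs-recip zero    zero    = _≡_.refl
    recipCoeffs-recip (suc n) zero    = _≡_.refl
    recipCoeffs-recip (suc n) (suc i) = recipCoeffs-recip n i

    *ˢ-recip : ∀ n → (f *ˢ recip) n ≈ 1ˢ n
    *ˢ-recip zero    = trans (+-identityʳ _) (inv-inverseʳ (f 0) f₀#0)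
    *ˢ-recip (suc n) = begin
      f 0 * - (c₀ * S) + S′  ≈⟨ +-congʳ (-‿distribʳ-* _ _) ⟨
      - (f 0 * (c₀ * S)) + S′ ≈⟨ +-congʳ (-‿cong (*-assoc _ _ _)) ⟨
      - (f 0 * c₀ * S) + S′  ≈⟨ +-congʳ (-‿cong (*-congʳ (inv-inverseʳ (f 0) f₀#0))) ⟩
      - (1# * S) + S′        ≈⟨ +-cong (-‿cong (*-identityˡ S)) (sym S≈S′) ⟩
      - S + S                ≈⟨ -‿inverseˡ S ⟩
      0#                     ∎
      where
      open SetoidReasoning setoid
      open HeytingField K using (-‿cong; -‿inverseˡ; reflexive)
      open Sum semiring using (sum-cong-≋)
      c₀ = inv (f 0) f₀#0
      S  = ∑[ i ≤ n ] (f (suc (toℕ i)) * recipCoeffs n i)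
      S′ = ∑[ i ≤ n ] (f (suc (toℕ i)) * recip (n ∸ toℕ i))
      S≈S′ : S ≈ S′
      S≈S′ = sum-cong-≋ λ i → *-congˡ {f (suc (toℕ i))} (reflexive (recipCoeffs-recip n i))

  -- t / f(t)
  t/ : (f : Series) → f 0 ≈ 0# → f 1 # 0# → Series
  t/ f f₀≈0 f₁#0 = recip (divideByT f f₀≈0) f₁#0

  -- The sequence a with f(t) = ∑ a n tⁿ / n!.
  egfCoeff : Series → ℕ → Carrier
  egfCoeff f n = ι (n !) * f n

  -- lam is λ, which is reserved in Agda.
  module _ (lam : Carrier) (lam#0 : lam # 0#) where

    1/lam : Carrier
    1/lam = inv lam lam#0

    -- e^x_λ(t)
    degExp^ : Carrier → Series
    degExp^ x n = binomial (x * 1/lam) n * lam ^ n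

    degExp : Series
    degExp = degExp^ 1#

    degExp₀≈1 : degExp 0 ≈ 1#
    degExp₀≈1 = trans (*-identityʳ _) (trans (*-congʳ (sym (+-identityʳ 1#)))
                  (inv-inverseʳ (ι 1) _))

    degExp₁≈1 : degExp 1 ≈ 1#
    degExp₁≈1 = begin
      1# * (1# * 1/lam - 0# * 1#) * 1/! 1 * (lam * 1#)
        ≈⟨ *-cong (*-congˡ 1/1≈1) (*-identityʳ lam) ⟩
      1# * (1# * 1/lam - 0# * 1#) * 1# * lam
        ≈⟨ *-congʳ (trans (*-identityʳ _) (*-identityˡ _)) ⟩
      (1# * 1/lam - 0# * 1#) * lam
        ≈⟨ *-congʳ (trans (+-cong (*-identityˡ _) (-‿cong (*-identityʳ 0#))) (x-0≈x _)) ⟩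
      1/lam * lam
        ≈⟨ inv-inverseˡ lam lam#0 ⟩
      1# ∎
      where
      open SetoidReasoning setoid
      open HeytingField K using (-‿cong)
      1/1≈1 : 1/! 1 ≈ 1#
      1/1≈1 = trans (sym (*-identityˡ _))
                (trans (*-congʳ (sym (+-identityʳ 1#))) (inv-inverseʳ (ι 1) _))

    degExp-1₀≈0 : (degExp -ˢ 1ˢ) 0 ≈ 0#
    degExp-1₀≈0 = trans (+-congʳ degExp₀≈1) (-‿inverseʳ 1#)

    degExp-1₁#0 : (degExp -ˢ 1ˢ) 1 # 0#
    degExp-1₁#0 = #-congʳ (sym (trans (x-0≈x _) degExp₁≈1)) 1#0

    -- β_{n,λ}(x)
    bernoulli : ℕ → Carrier → Carrier
    bernoulli n x =
      egfCoeff (t/ (degExp -ˢ 1ˢ) degExp-1₀≈0 degExp-1₁#0 *ˢ degExp^ x) n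

    -- l_{k,λ}
    polylog : ℤ → Series
    polylog k zero    = 0#
    polylog k (suc n) =
      (- lam) ^ n * falling 1# (suc n) 1/lam * 1/! n * 1/⟨ suc n ⟩^ k

    1-degExp[-t]₀≈0 : (1ˢ -ˢ degExp [-t]) 0 ≈ 0#
    1-degExp[-t]₀≈0 = trans (+-congˡ (-‿cong (trans (*-identityˡ _) degExp₀≈1)))
                        (-‿inverseʳ 1#)
      where open HeytingField K using (-‿cong)

    -- β_{n,λ}^{(k)}
    polyBernoulli : ℤ → ℕ → Carrier
    polyBernoulli k =
      egfCoeff (substitute (divideByT (polylog k) refl)
                           (1ˢ -ˢ degExp [-t]) 1-degExp[-t]₀≈0)

{-# OPTIONS --safe #-}
module Submission where

-- Put u = 1 - e_λ(t) and let l_k be the k-th degenerate polylogarithm, so that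
-- x l_{k+1}′ = l_k.  By the chain rule (u · (l_{k+1}/x)(u))′ = u′ · (l_k/x)(u),
-- where u′ = - e_λ^{1-λ}.
-- For k = 0: F = l_0/x satisfies (1 - x) F′ = (1 - λ) F, and hence
-- e_λ^{1-λ} · F(u) is annihilated by (1 + λt) d/dt and equals 1.
-- For k = 1: it follows that l_1(u) = - t, that is (l_1/x)(u) = t / (e_λ - 1).
-- For k = 2: l_2(u) is therefore the integral of - t e_λ^{1-λ} / (e_λ - 1), and
-- dividing by u gives (l_2/x)(u) as a product of two exponential generating
-- functions.  The sign (-1)ⁿ comes from 1 - e_λ(-t) = u(-t).

open import Defs
open import Algebra.Apartness.Bundles using (HeytingField)
open import Algebra.Bundles using (CommutativeRing)
import Algebra.Apartness.Properties.HeytingCommutativeRing as HCRProperties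
import Algebra.Properties.Ring as RingProperties
import Algebra.Properties.Semiring.Exp as Exp
import Algebra.Properties.Semiring.Mult as Mult
import Algebra.Properties.Semiring.Sum as Sum
import Algebra.Solver.Ring.NaturalCoefficients.Default as SemiringSolver
open import Data.Fin.Base using (Fin; toℕ)
open import Data.Fin.Properties using (toℕ≤pred[n])
open import Data.Integer.Base using (+_)
open import Data.Nat.Base as ℕ using (ℕ; zero; suc; _∸_; _≤_; _<_; s≤s; NonZero; _!)
import Data.Nat.Properties as ℕ
open import Data.Nat.Combinatorics using (nCk≡n!/k![n-k]!; k![n∸k]!∣n!)
open import Data.Nat.DivMod using (m/n*n≡m)
open import Data.Nat.Combinatorics.Base using (_C_)
open import Data.Product.Base using (_×_; _,_)
open import Relation.Binary.PropositionalEquality.Core as ≡ using (_≡_)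
import Relation.Binary.Reasoning.Setoid as SetoidReasoning

module PowerSeries {c ℓ₁ ℓ₂} (K : HeytingField c ℓ₁ ℓ₂) (char0 : CharacteristicZero K) where

  open HeytingFieldOps K public
  open Degenerate K char0 public
  open CommutativeRing commutativeRing public
    using ( setoid; refl; sym; trans; reflexive; zeroˡ; zeroʳ; distribˡ; distribʳ
          ; +-cong; +-congˡ; +-congʳ; +-assoc; +-comm; +-identityˡ; +-identityʳ
          ; *-cong; *-congˡ; *-congʳ; *-assoc; *-comm; *-identityˡ; *-identityʳ
          ; -‿cong; -‿inverseˡ; -‿inverseʳ; commutativeSemiring)
  open Mult semiring public using (×-homo-+; ×1-homo-*)
  open Exp semiring public using (^-homo-*)
  open RingProperties ring public
    using (-‿distribˡ-*; -‿distribʳ-*; -‿+-comm; -‿involutive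
          ; [y-z]x≈yx-zx; x[y-z]≈xy-xz; -‿injective; +-inverseˡ-unique; +-cancelʳ)
  open HCRProperties heytingCommutativeRing public using (x-0≈x)
  open Sum semiring public using (sum-cong-≋; ∑-distrib-+; *-distribˡ-sum; sum-replicate-zero; sum-syntax)
  module KSolver = SemiringSolver commutativeSemiring
  module KReasoning = SetoidReasoning setoid

  ∑-last : (g : ℕ → Carrier) (n : ℕ) →
           ∑[ i ≤ n ] g (toℕ i) ≈ ∑[ i < n ] g (toℕ i) + g n
  ∑-last g zero    = +-comm _ _
  ∑-last g (suc n) = trans (+-congˡ (∑-last (λ k → g (suc k)) n)) (sym (+-assoc _ _ _))

  -- Formal power series as a commutative ring.

  infix 4 _≋_
  infixl 6 _+ˢ_

  _≋_ : Series → Series → Set ℓ₁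
  f ≋ g = ∀ n → f n ≈ g n

  _+ˢ_ : Series → Series → Series
  (f +ˢ g) n = f n + g n

  -ˢ_ : Series → Series
  (-ˢ f) n = - f n

  const : Carrier → Series
  const a zero    = a
  const a (suc n) = 0#

  0ˢ : Series
  0ˢ n = 0#

  tail : Series → Series
  tail f n = f (suc n)

  delay : Series → Series
  delay f zero    = 0#
  delay f (suc n) = f n

  *ˢ-cong : ∀ {f f′ g g′} → f ≋ f′ → g ≋ g′ → f *ˢ g ≋ f′ *ˢ g′
  *ˢ-cong f≋f′ g≋g′ n = sum-cong-≋ {suc n} λ i → *-cong (f≋f′ (toℕ i)) (g≋g′ (n ∸ toℕ i))

  *ˢ-vanish : ∀ a g n → (∀ i → i ≤ n → g i ≈ 0#) → (a *ˢ g) n ≈ 0#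
  *ˢ-vanish a g n g≈0 = trans
    (sum-cong-≋ {suc n} λ i → trans (*-congˡ (g≈0 _ (ℕ.m∸n≤m n (toℕ i)))) (zeroʳ (a (toℕ i))))
    (sum-replicate-zero (suc n))

  -- The Cauchy product unfolds by computation at its first summand; this is the mirror unfolding at
  -- the last one. Together they drive commutativity and the Leibniz rule.
  *ˢ-suc-last : ∀ f g n → (f *ˢ g) (suc n) ≈ (f *ˢ tail g) n + f (suc n) * g 0
  *ˢ-suc-last f g zero    = KSolver.solve 2 (λ x y → x :+ (y :+ con 0) := (x :+ con 0) :+ y) refl _ _
    where open KSolver
  *ˢ-suc-last f g (suc n) =
    trans (+-congˡ (*ˢ-suc-last (tail f) g n)) (sym (+-assoc _ _ _))

  *ˢ-comm : ∀ f g → f *ˢ g ≋ g *ˢ f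
  *ˢ-comm f g zero    = +-congʳ (*-comm _ _)
  *ˢ-comm f g (suc n) = begin
    f 0 * g (suc n) + (tail f *ˢ g) n  ≈⟨ +-cong (*-comm _ _) (*ˢ-comm (tail f) g n) ⟩
    g (suc n) * f 0 + (g *ˢ tail f) n  ≈⟨ +-comm _ _ ⟩
    (g *ˢ tail f) n + g (suc n) * f 0  ≈⟨ *ˢ-suc-last g f n ⟨
    (g *ˢ f) (suc n)                   ∎
    where open KReasoning

  *ˢ-distribʳ : ∀ h f g → (f +ˢ g) *ˢ h ≋ (f *ˢ h) +ˢ (g *ˢ h)
  *ˢ-distribʳ h f g n = trans (sum-cong-≋ {suc n} λ i → distribʳ (h (n ∸ toℕ i)) (f (toℕ i)) (g (toℕ i)))
    (∑-distrib-+ {suc n} (λ i → f (toℕ i) * h (n ∸ toℕ i)) (λ i → g (toℕ i) * h (n ∸ toℕ i)))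

  scale-*ˢ : ∀ a f g n → ((λ k → a * f k) *ˢ g) n ≈ a * (f *ˢ g) n
  scale-*ˢ a f g n = trans (sum-cong-≋ {suc n} λ i → *-assoc a (f (toℕ i)) (g (n ∸ toℕ i)))
    (sym (*-distribˡ-sum {suc n} a (λ i → f (toℕ i) * g (n ∸ toℕ i))))

  *ˢ-assoc : ∀ f g h → (f *ˢ g) *ˢ h ≋ f *ˢ (g *ˢ h)
  *ˢ-assoc f g h zero    = KSolver.solve 3
    (λ x y z → ((x :* y :+ con 0) :* z :+ con 0) := (x :* (y :* z :+ con 0) :+ con 0)) refl _ _ _
    where open KSolver
  *ˢ-assoc f g h (suc n) = begin
    (f 0 * g 0 + 0#) * h (suc n) + (((λ k → f 0 * tail g k) +ˢ (tail f *ˢ g)) *ˢ h) n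
      -- By computation `tail (f *ˢ g)` is `f 0` times `tail g` plus `tail f *ˢ g`, so associativity
      -- for `tail f` closes the induction.
      ≈⟨ +-congˡ (*ˢ-distribʳ h (λ k → f 0 * tail g k) (tail f *ˢ g) n) ⟩
    (f 0 * g 0 + 0#) * h (suc n) + (((λ k → f 0 * tail g k) *ˢ h) n + ((tail f *ˢ g) *ˢ h) n)
      ≈⟨ +-congˡ (+-cong (scale-*ˢ (f 0) (tail g) h n) (*ˢ-assoc (tail f) g h n)) ⟩
    (f 0 * g 0 + 0#) * h (suc n) + (f 0 * (tail g *ˢ h) n + (tail f *ˢ (g *ˢ h)) n)
      ≈⟨ KSolver.solve 5 (λ x y z v w → ((x :* y :+ con 0) :* z :+ (x :* v :+ w))
                               := (x :* (y :* z :+ v) :+ w)) refl _ _ _ _ _ ⟩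
    f 0 * (g 0 * h (suc n) + (tail g *ˢ h) n) + (tail f *ˢ (g *ˢ h)) n  ∎
    where
    open KReasoning
    open KSolver

  const-*ˢ : ∀ a f n → (const a *ˢ f) n ≈ a * f n
  const-*ˢ a f zero    = +-identityʳ _
  const-*ˢ a f (suc n) = trans (+-congˡ (trans (*ˢ-comm 0ˢ f n) (*ˢ-vanish f 0ˢ n λ _ _ → refl)))
                           (+-identityʳ _)

  1ˢ≋const : 1ˢ ≋ const 1#
  1ˢ≋const zero    = refl
  1ˢ≋const (suc n) = refl

  *ˢ-identityˡ : ∀ f → 1ˢ *ˢ f ≋ f
  *ˢ-identityˡ f n = begin
    (1ˢ *ˢ f) n        ≈⟨ *ˢ-cong {1ˢ} {const 1#} {f} {f} 1ˢ≋const (λ _ → refl) n ⟩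
    (const 1# *ˢ f) n  ≈⟨ const-*ˢ 1# f n ⟩
    1# * f n           ≈⟨ *-identityˡ _ ⟩
    f n                ∎
    where open KReasoning

  seriesRing : CommutativeRing c ℓ₁
  seriesRing = record
    { Carrier = Series ; _≈_ = _≋_ ; _+_ = _+ˢ_ ; _*_ = _*ˢ_ ; -_ = -ˢ_ ; 0# = 0ˢ ; 1# = 1ˢ
    ; isCommutativeRing = record
      { isRing = record
        { +-isAbelianGroup = record
          { isGroup = record
            { isMonoid = record
              { isSemigroup = record
                { isMagma = record
                  { isEquivalence = record
                    { refl = λ _ → refl ; sym = λ p n → sym (p n) ; trans = λ p q n → trans (p n) (q n) }
                  ; ∙-cong = λ p q n → +-cong (p n) (q n) }
                ; assoc = λ f g h n → +-assoc _ _ _ }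
              ; identity = (λ f n → +-identityˡ _) , (λ f n → +-identityʳ _) }
            ; inverse = (λ f n → -‿inverseˡ _) , (λ f n → -‿inverseʳ _)
            ; ⁻¹-cong = λ p n → -‿cong (p n) }
          ; comm = λ f g n → +-comm _ _ }
        ; *-cong = *ˢ-cong
        ; *-assoc = *ˢ-assoc
        ; *-identity = *ˢ-identityˡ , λ f n → trans (*ˢ-comm f 1ˢ n) (*ˢ-identityˡ f n)
        ; distrib = (λ h f g n → trans (*ˢ-comm h (f +ˢ g) n)
                       (trans (*ˢ-distribʳ h f g n) (+-cong (*ˢ-comm f h n) (*ˢ-comm g h n))))
                  , *ˢ-distribʳ }
      ; *-comm = *ˢ-comm } }

  open CommutativeRing seriesRing public using ()
    renaming ( setoid to ≋-setoid; refl to ≋-refl; sym to ≋-sym; trans to ≋-trans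
             ; +-cong to +ˢ-cong; +-congˡ to +ˢ-congˡ; +-congʳ to +ˢ-congʳ
             ; *-congˡ to *ˢ-congˡ; *-congʳ to *ˢ-congʳ
             ; commutativeSemiring to seriesSemiring
             ; *-identityʳ to *ˢ-identityʳ; zeroˡ to *ˢ-zeroˡ)
  module SSolver = SemiringSolver seriesSemiring
  module SReasoning = SetoidReasoning ≋-setoid

  -- Derivative

  D : Series → Series
  D f n = ι (suc n) * f (suc n)

  D-cong : ∀ {f g} → f ≋ g → D f ≋ D g
  D-cong f≋g n = *-congˡ (f≋g (suc n))

  -- The operator t d/dt. It preserves degrees, so its Leibniz rule is the splitting n = i + (n - i)
  -- in each summand of the product.
  euler : Series → Series
  euler f n = ι n * f n

  euler-*ˢ : ∀ f g → euler (f *ˢ g) ≋ (euler f *ˢ g) +ˢ (f *ˢ euler g)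
  euler-*ˢ f g n = begin
    ι n * (∑[ i ≤ n ] (f (toℕ i) * g (n ∸ toℕ i)))
      ≈⟨ *-distribˡ-sum {suc n} (ι n) (λ i → f (toℕ i) * g (n ∸ toℕ i)) ⟩
    (∑[ i ≤ n ] (ι n * (f (toℕ i) * g (n ∸ toℕ i))))
      ≈⟨ sum-cong-≋ {suc n} (λ i → trans (*-congʳ (ι-split i))
           (KSolver.solve 4 (λ a b x y → (a :+ b) :* (x :* y) := a :* x :* y :+ x :* (b :* y)) refl
              (ι (toℕ i)) (ι (n ∸ toℕ i)) (f (toℕ i)) (g (n ∸ toℕ i)))) ⟩
    (∑[ i ≤ n ] (euler f (toℕ i) * g (n ∸ toℕ i) + f (toℕ i) * euler g (n ∸ toℕ i)))
      ≈⟨ ∑-distrib-+ {suc n} (λ i → euler f (toℕ i) * g (n ∸ toℕ i)) (λ i → f (toℕ i) * euler g (n ∸ toℕ i)) ⟩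
    (euler f *ˢ g) n + (f *ˢ euler g) n  ∎
    where
    open KReasoning
    open KSolver
    ι-split : ∀ (i : Fin (suc n)) → ι n ≈ ι (toℕ i) + ι (n ∸ toℕ i)
    ι-split i = trans (reflexive (≡.cong ι (≡.sym (ℕ.m+[n∸m]≡n (toℕ≤pred[n] i)))))
                  (×-homo-+ 1# (toℕ i) (n ∸ toℕ i))

  -- `D f n` is `euler f (suc n)`, so this is the Leibniz rule for `euler` one index higher; the two
  -- boundary terms carry the factor `ι 0` and vanish.
  D-*ˢ : ∀ f g → D (f *ˢ g) ≋ (D f *ˢ g) +ˢ (f *ˢ D g)
  D-*ˢ f g n = begin
    D (f *ˢ g) n
      ≈⟨ euler-*ˢ f g (suc n) ⟩
    (0# * f 0 * g (suc n) + (D f *ˢ g) n) + (f *ˢ euler g) (suc n)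
      ≈⟨ +-congˡ (*ˢ-suc-last f (euler g) n) ⟩
    (0# * f 0 * g (suc n) + (D f *ˢ g) n) + ((f *ˢ D g) n + f (suc n) * (0# * g 0))
      ≈⟨ KSolver.solve 6 (λ a b c d e h → (con 0 :* a :* b :+ c) :+ (d :+ e :* (con 0 :* h)) := c :+ d) refl
           (f 0) (g (suc n)) ((D f *ˢ g) n) ((f *ˢ D g) n) (f (suc n)) (g 0) ⟩
    (D f *ˢ g) n + (f *ˢ D g) n  ∎
    where
    open KReasoning
    open KSolver

  const-+ : ∀ a b → const (a + b) ≋ const a +ˢ const b
  const-+ a b zero    = refl
  const-+ a b (suc n) = sym (+-identityˡ 0#)

  D-^ˢ : ∀ u m → D (u ^ˢ suc m) ≋ const (ι (suc m)) *ˢ (D u *ˢ (u ^ˢ m))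
  D-^ˢ u m = begin
    D (u *ˢ (u ^ˢ m))
      ≈⟨ D-*ˢ u (u ^ˢ m) ⟩
    (D u *ˢ (u ^ˢ m)) +ˢ (u *ˢ D (u ^ˢ m))
      ≈⟨ +ˢ-congˡ (rest m) ⟩
    (D u *ˢ (u ^ˢ m)) +ˢ (const (ι m) *ˢ (D u *ˢ (u ^ˢ m)))
      ≈⟨ SSolver.solve 2 (λ x y → y :+ x :* y := (con 1 :+ x) :* y) ≋-refl (const (ι m)) (D u *ˢ (u ^ˢ m)) ⟩
    (1ˢ +ˢ const (ι m)) *ˢ (D u *ˢ (u ^ˢ m))
      ≈⟨ *ˢ-congʳ (≋-trans (+ˢ-congʳ 1ˢ≋const) (≋-sym (const-+ 1# (ι m)))) ⟩
    const (ι (suc m)) *ˢ (D u *ˢ (u ^ˢ m))  ∎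
    where
    open SReasoning
    open SSolver
    -- With u^m in place of u^(m-1) the statement makes sense at m = 0, where both sides vanish; the
    -- successor case calls `D-^ˢ` at m.
    rest : ∀ m → u *ˢ D (u ^ˢ m) ≋ const (ι m) *ˢ (D u *ˢ (u ^ˢ m))
    rest zero n = trans
      (*ˢ-vanish u (D 1ˢ) n (λ i _ → zeroʳ _))
      (sym (trans (const-*ˢ 0# (D u *ˢ 1ˢ) n) (zeroˡ _)))
    rest (suc m) = begin
      u *ˢ D (u ^ˢ suc m)
        ≈⟨ *ˢ-congˡ {u} (D-^ˢ u m) ⟩
      u *ˢ (const (ι (suc m)) *ˢ (D u *ˢ (u ^ˢ m)))
        ≈⟨ SSolver.solve 4 (λ u k d p → u :* (k :* (d :* p)) := k :* (d :* (u :* p))) ≋-refl u (const (ι (suc m))) (D u) (u ^ˢ m) ⟩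
      const (ι (suc m)) *ˢ (D u *ˢ (u ^ˢ suc m))  ∎

  -- Composition

  -- The cut-off k of the inner sum varies with the coefficient, so the sum cannot simply be pulled
  -- out of the product. Since `w m` has no coefficient below index m, every cut-off may be raised
  -- to n.
  *ˢ-triangular : ∀ (w : ℕ → Series) → (∀ m n → n < m → w m n ≈ 0#) → ∀ a n →
                  (a *ˢ (λ k → ∑[ m ≤ k ] w (toℕ m) k)) n ≈ ∑[ m ≤ n ] (a *ˢ w (toℕ m)) n
  *ˢ-triangular w w≈0 a zero    = KSolver.solve 2
    (λ x y → x :* (y :+ con 0) :+ con 0 := x :* y :+ con 0 :+ con 0) refl (a 0) (w 0 0)
    where open KSolver
  *ˢ-triangular w w≈0 a (suc n) = begin
    a 0 * (∑[ m ≤ suc n ] w (toℕ m) (suc n)) + (tail a *ˢ (λ k → ∑[ m ≤ k ] w (toℕ m) k)) n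
      ≈⟨ +-cong (*-distribˡ-sum {suc (suc n)} (a 0) (λ m → w (toℕ m) (suc n)))
                (*ˢ-triangular w w≈0 (tail a) n) ⟩
    (∑[ m ≤ suc n ] (a 0 * w (toℕ m) (suc n))) + (∑[ m ≤ n ] (tail a *ˢ w (toℕ m)) n)
      ≈⟨ +-congˡ extend ⟨
    (∑[ m ≤ suc n ] (a 0 * w (toℕ m) (suc n))) + (∑[ m ≤ suc n ] (tail a *ˢ w (toℕ m)) n)
      ≈⟨ ∑-distrib-+ {suc (suc n)} (λ m → a 0 * w (toℕ m) (suc n)) (λ m → (tail a *ˢ w (toℕ m)) n) ⟨
    (∑[ m ≤ suc n ] (a *ˢ w (toℕ m)) (suc n))  ∎
    where
    open KReasoning
    extend : ∑[ m ≤ suc n ] (tail a *ˢ w (toℕ m)) n ≈ ∑[ m ≤ n ] (tail a *ˢ w (toℕ m)) n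
    extend = trans (∑-last (λ m → (tail a *ˢ w m) n) (suc n))
      (trans (+-congˡ (*ˢ-vanish (tail a) (w (suc n)) n λ i i≤n → w≈0 (suc n) i (s≤s i≤n)))
             (+-identityʳ _))

  ^ˢ-vanish : ∀ u → u 0 ≈ 0# → ∀ m n → n < m → (u ^ˢ m) n ≈ 0#
  ^ˢ-vanish u u₀≈0 (suc m) zero    _         = trans (+-identityʳ _) (trans (*-congʳ u₀≈0) (zeroˡ _))
  ^ˢ-vanish u u₀≈0 (suc m) (suc n) (s≤s n<m) = trans
    (+-cong (trans (*-congʳ u₀≈0) (zeroˡ _))
            (*ˢ-vanish (tail u) (u ^ˢ m) n λ i i≤n → ^ˢ-vanish u u₀≈0 m i (ℕ.≤-<-trans i≤n n<m)))
    (+-identityʳ 0#)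

  module _ (u : Series) (u₀≈0 : u 0 ≈ 0#) where

    _∘u : Series → Series
    f ∘u = substitute f u u₀≈0

    ∘-cong : ∀ {f g} → f ≋ g → (f ∘u) ≋ (g ∘u)
    ∘-cong f≋g n = sum-cong-≋ {suc n} λ m → *-congʳ {(u ^ˢ toℕ m) n} (f≋g (toℕ m))

    ∘-+ : ∀ f g → ((f +ˢ g) ∘u) ≋ (f ∘u) +ˢ (g ∘u)
    ∘-+ f g n = trans (sum-cong-≋ {suc n} λ m → distribʳ ((u ^ˢ toℕ m) n) (f (toℕ m)) (g (toℕ m)))
      (∑-distrib-+ {suc n} (λ m → f (toℕ m) * (u ^ˢ toℕ m) n) (λ m → g (toℕ m) * (u ^ˢ toℕ m) n))

    ∘-scale : ∀ a f → ((const a *ˢ f) ∘u) ≋ const a *ˢ (f ∘u)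
    ∘-scale a f n = trans
      (sum-cong-≋ {suc n} λ m → trans (*-congʳ {(u ^ˢ toℕ m) n} (const-*ˢ a f (toℕ m)))
                                      (*-assoc a (f (toℕ m)) ((u ^ˢ toℕ m) n)))
      (trans (sym (*-distribˡ-sum {suc n} a (λ m → f (toℕ m) * (u ^ˢ toℕ m) n)))
             (sym (const-*ˢ a (f ∘u) n)))

    -- Reduces a product with a composite to products with powers of u; both `delay-∘` and the chain
    -- rule rest on it.
    *ˢ-∘ : ∀ a f n → (a *ˢ (f ∘u)) n ≈ ∑[ m ≤ n ] (f (toℕ m) * (a *ˢ (u ^ˢ toℕ m)) n)
    *ˢ-∘ a f n = trans
      (*ˢ-triangular (λ m k → f m * (u ^ˢ m) k)
        (λ m k k<m → trans (*-congˡ (^ˢ-vanish u u₀≈0 m k k<m)) (zeroʳ _)) a n)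
      (sum-cong-≋ {suc n} λ m → pull (toℕ m))
      where
      open KReasoning
      pull : ∀ m → (a *ˢ (λ k → f m * (u ^ˢ m) k)) n ≈ f m * (a *ˢ (u ^ˢ m)) n
      pull m = begin
        (a *ˢ (λ k → f m * (u ^ˢ m) k)) n  ≈⟨ *ˢ-comm a (λ k → f m * (u ^ˢ m) k) n ⟩
        ((λ k → f m * (u ^ˢ m) k) *ˢ a) n  ≈⟨ scale-*ˢ (f m) (u ^ˢ m) a n ⟩
        f m * ((u ^ˢ m) *ˢ a) n            ≈⟨ *-congˡ (*ˢ-comm (u ^ˢ m) a n) ⟩
        f m * (a *ˢ (u ^ˢ m)) n            ∎

    delay-∘ : ∀ f → (delay f ∘u) ≋ u *ˢ (f ∘u)
    delay-∘ f n = begin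
      0# * 1ˢ n + (∑[ m < n ] (f (toℕ m) * (u ^ˢ suc (toℕ m)) n))
        ≈⟨ trans (+-congʳ (zeroˡ _)) (+-identityˡ _) ⟩
      (∑[ m < n ] (f (toℕ m) * (u ^ˢ suc (toℕ m)) n))
        -- The shift by `delay` leaves one summand too few; the missing one contains coefficient n
        -- of u^(n+1), which is zero.
        ≈⟨ trans (+-congˡ (trans (*-congˡ (^ˢ-vanish u u₀≈0 (suc n) n (ℕ.n<1+n n))) (zeroʳ _))) (+-identityʳ _) ⟨
      (∑[ m < n ] (f (toℕ m) * (u ^ˢ suc (toℕ m)) n)) + f n * (u ^ˢ suc n) n
        ≈⟨ ∑-last (λ m → f m * (u ^ˢ suc m) n) n ⟨
      (∑[ m ≤ n ] (f (toℕ m) * (u ^ˢ suc (toℕ m)) n))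
        ≈⟨ *ˢ-∘ u f n ⟨
      (u *ˢ (f ∘u)) n  ∎
      where open KReasoning

    D-∘ : ∀ f → D (f ∘u) ≋ D u *ˢ (D f ∘u)
    D-∘ f n = begin
      ι (suc n) * (f 0 * 0# + S)
        -- The term m = 0 drops out because `u ^ˢ 0` is constant; the remaining exponents are
        -- successors, ready for the power rule.
        ≈⟨ *-congˡ (trans (+-congʳ (zeroʳ (f 0))) (+-identityˡ S)) ⟩
      ι (suc n) * S
        ≈⟨ *-distribˡ-sum {suc n} (ι (suc n)) (λ m → f (suc (toℕ m)) * (u ^ˢ suc (toℕ m)) (suc n)) ⟩
      (∑[ m ≤ n ] (ι (suc n) * (f (suc (toℕ m)) * (u ^ˢ suc (toℕ m)) (suc n))))
        ≈⟨ sum-cong-≋ {suc n} (λ m → term (toℕ m)) ⟩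
      (∑[ m ≤ n ] (D f (toℕ m) * (D u *ˢ (u ^ˢ toℕ m)) n))
        ≈⟨ *ˢ-∘ (D u) (D f) n ⟨
      (D u *ˢ (D f ∘u)) n  ∎
      where
      open KReasoning
      S = ∑[ m ≤ n ] (f (suc (toℕ m)) * (u ^ˢ suc (toℕ m)) (suc n))
      term : ∀ m → ι (suc n) * (f (suc m) * (u ^ˢ suc m) (suc n)) ≈ D f m * (D u *ˢ (u ^ˢ m)) n
      term m = begin
        ι (suc n) * (f (suc m) * (u ^ˢ suc m) (suc n))
          ≈⟨ KSolver.solve 3 (λ x y z → x :* (y :* z) := y :* (x :* z)) refl (ι (suc n)) (f (suc m)) ((u ^ˢ suc m) (suc n)) ⟩
        f (suc m) * D (u ^ˢ suc m) n
          ≈⟨ *-congˡ (trans (D-^ˢ u m n) (const-*ˢ (ι (suc m)) (D u *ˢ (u ^ˢ m)) n)) ⟩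
        f (suc m) * (ι (suc m) * (D u *ˢ (u ^ˢ m)) n)
          ≈⟨ KSolver.solve 3 (λ x y z → x :* (y :* z) := y :* x :* z) refl (f (suc m)) (ι (suc m)) ((D u *ˢ (u ^ˢ m)) n) ⟩
        D f m * (D u *ˢ (u ^ˢ m)) n  ∎
        where open KSolver

  -- Consequences of characteristic zero

  ι1≈1 : ι 1 ≈ 1#
  ι1≈1 = +-identityʳ 1#

  1/ι-inverseʳ : ∀ n → .{{_ : NonZero n}} → ι n * 1/ι n ≈ 1#
  1/ι-inverseʳ n = inv-inverseʳ (ι n) (char0 n)

  *-1/ι : ∀ n → .{{_ : NonZero n}} → ∀ {x y} → ι n * x ≈ y → x ≈ y * 1/ι n
  *-1/ι n {x} {y} nx≈y = begin
    x                   ≈⟨ *-identityʳ x ⟨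
    x * 1#              ≈⟨ *-congˡ (1/ι-inverseʳ n) ⟨
    x * (ι n * 1/ι n)   ≈⟨ KSolver.solve 3 (λ x i j → x :* (i :* j) := i :* x :* j) refl x (ι n) (1/ι n) ⟩
    ι n * x * 1/ι n     ≈⟨ *-congʳ nx≈y ⟩
    y * 1/ι n           ∎
    where
    open KReasoning
    open KSolver

  ι-cancelˡ : ∀ n → .{{_ : NonZero n}} → ∀ {x y} → ι n * x ≈ ι n * y → x ≈ y
  ι-cancelˡ n nx≈ny = trans (*-1/ι n nx≈ny) (sym (*-1/ι n refl))

  1/!-suc : ∀ n → ι (suc n) * 1/! (suc n) ≈ 1/! n
  1/!-suc n = ι-cancelˡ (n !) {{n ℕ.!≢0}} (begin
    ι (n !) * (ι (suc n) * 1/! (suc n))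
      ≈⟨ KSolver.solve 3 (λ a b c → a :* (b :* c) := (b :* a) :* c) refl (ι (n !)) (ι (suc n)) (1/! (suc n)) ⟩
    ι (suc n) * ι (n !) * 1/! (suc n)
      ≈⟨ *-congʳ (×1-homo-* (suc n) (n !)) ⟨
    ι (suc n !) * 1/! (suc n)
      ≈⟨ 1/ι-inverseʳ (suc n !) {{suc n ℕ.!≢0}} ⟩
    1#
      ≈⟨ 1/ι-inverseʳ (n !) {{n ℕ.!≢0}} ⟨
    ι (n !) * 1/! n  ∎)
    where
    open KReasoning
    open KSolver

  1/!0≈1 : 1/! 0 ≈ 1#
  1/!0≈1 = ι-cancelˡ 1 (trans (1/ι-inverseʳ 1) (sym (trans (*-identityʳ _) ι1≈1)))

  D-injective : ∀ {f g} → f 0 ≈ g 0 → D f ≋ D g → f ≋ g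
  D-injective f₀≈g₀ Df≋Dg zero    = f₀≈g₀
  D-injective f₀≈g₀ Df≋Dg (suc n) = ι-cancelˡ (suc n) (Df≋Dg n)

  -- As n + 1 is invertible, the constant term and the recurrence fix all coefficients. Series can
  -- thus be identified without comparing closed forms.
  recurrence-unique : ∀ (a : ℕ → Carrier) {f g} → f 0 ≈ g 0 →
                      (∀ n → D f n ≈ a n * f n) → (∀ n → D g n ≈ a n * g n) → f ≋ g
  recurrence-unique a f₀≈g₀ Df Dg zero    = f₀≈g₀
  recurrence-unique a f₀≈g₀ Df Dg (suc n) = ι-cancelˡ (suc n)
    (trans (Df n) (trans (*-congˡ (recurrence-unique a f₀≈g₀ Df Dg n)) (sym (Dg n))))

  nCk*[k!*[n∸k]!]≡n! : ∀ {n k} → k ≤ n → (n C k) ℕ.* (k ! ℕ.* (n ∸ k) !) ≡ n !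
  nCk*[k!*[n∸k]!]≡n! {n} {k} k≤n = ≡.trans
    (≡.cong (ℕ._* (k ! ℕ.* (n ∸ k) !)) (nCk≡n!/k![n-k]! k≤n))
    (m/n*n≡m {{k ℕ.!* (n ∸ k) !≢0}} (k![n∸k]!∣n! k≤n))

  -- Binomial convolution: n! is `n C k` times k! (n - k)!, and the two factorials are absorbed by
  -- the two coefficients.
  egfCoeff-*ˢ : ∀ f g n → egfCoeff (f *ˢ g) n ≈
                ∑[ m ≤ n ] (ι (n C toℕ m) * (egfCoeff f (toℕ m) * egfCoeff g (n ∸ toℕ m)))
  egfCoeff-*ˢ f g n = trans
    (*-distribˡ-sum {suc n} (ι (n !)) (λ m → f (toℕ m) * g (n ∸ toℕ m)))
    (sum-cong-≋ {suc n} λ m → term (toℕ m) (toℕ≤pred[n] m))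
    where
    open KReasoning
    open KSolver
    term : ∀ k → k ≤ n → ι (n !) * (f k * g (n ∸ k)) ≈ ι (n C k) * (egfCoeff f k * egfCoeff g (n ∸ k))
    term k k≤n = begin
      ι (n !) * (f k * g (n ∸ k))
        ≈⟨ *-congʳ (reflexive (≡.cong ι (nCk*[k!*[n∸k]!]≡n! k≤n))) ⟨
      ι ((n C k) ℕ.* (k ! ℕ.* (n ∸ k) !)) * (f k * g (n ∸ k))
        ≈⟨ *-congʳ (trans (×1-homo-* (n C k) _) (*-congˡ (×1-homo-* (k !) ((n ∸ k) !)))) ⟩
      ι (n C k) * (ι (k !) * ι ((n ∸ k) !)) * (f k * g (n ∸ k))
        ≈⟨ KSolver.solve 5 (λ a b c x y → a :* (b :* c) :* (x :* y) := a :* ((b :* x) :* (c :* y))) refl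
             (ι (n C k)) (ι (k !)) (ι ((n ∸ k) !)) (f k) (g (n ∸ k)) ⟩
      ι (n C k) * (egfCoeff f k * egfCoeff g (n ∸ k))  ∎

  -- The substitution t ↦ -t

  [-t]-*ˢ : ∀ f g → (f [-t]) *ˢ (g [-t]) ≋ (f *ˢ g) [-t]
  [-t]-*ˢ f g n = trans
    (sum-cong-≋ {suc n} λ i → term (toℕ i) (toℕ≤pred[n] i))
    (sym (*-distribˡ-sum {suc n} ((- 1#) ^ n) (λ i → f (toℕ i) * g (n ∸ toℕ i))))
    where
    open KSolver
    term : ∀ k → k ≤ n → (- 1#) ^ k * f k * ((- 1#) ^ (n ∸ k) * g (n ∸ k))
                       ≈ (- 1#) ^ n * (f k * g (n ∸ k))
    term k k≤n = trans
      (KSolver.solve 4 (λ a x b y → a :* x :* (b :* y) := a :* b :* (x :* y)) refl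
         ((- 1#) ^ k) (f k) ((- 1#) ^ (n ∸ k)) (g (n ∸ k)))
      (*-congʳ (trans (sym (^-homo-* (- 1#) k (n ∸ k)))
                      (reflexive (≡.cong ((- 1#) ^_) (ℕ.m+[n∸m]≡n k≤n)))))

  1ˢ[-t] : 1ˢ [-t] ≋ 1ˢ
  1ˢ[-t] zero    = *-identityˡ 1#
  1ˢ[-t] (suc n) = zeroʳ _

  ^ˢ-[-t] : ∀ f {g} → g ≋ f [-t] → ∀ m → g ^ˢ m ≋ (f ^ˢ m) [-t]
  ^ˢ-[-t] f g≋ zero    = ≋-sym 1ˢ[-t]
  ^ˢ-[-t] f g≋ (suc m) = ≋-trans (*ˢ-cong g≋ (^ˢ-[-t] f g≋ m)) ([-t]-*ˢ f (f ^ˢ m))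

  -- Coefficient n of any power of u(-t) is (-1)^n times that of the same power of u, whatever the
  -- exponent, so the sign leaves the sum.
  substitute-[-t] : ∀ h u u₀≈0 g g₀≈0 → g ≋ u [-t] → substitute h g g₀≈0 ≋ (substitute h u u₀≈0) [-t]
  substitute-[-t] h u u₀≈0 g g₀≈0 g≋ n = trans
    (sum-cong-≋ {suc n} λ m → trans (*-congˡ {h (toℕ m)} (^ˢ-[-t] u g≋ (toℕ m) n))
      (KSolver.solve 3 (λ x y z → x :* (y :* z) := y :* (x :* z)) refl (h (toℕ m)) ((- 1#) ^ n) ((u ^ˢ toℕ m) n)))
    (sym (*-distribˡ-sum {suc n} ((- 1#) ^ n) (λ m → h (toℕ m) * (u ^ˢ toℕ m) n)))
    where open KSolver

module PolyBernoulli {c ℓ₁ ℓ₂} (K : HeytingField c ℓ₁ ℓ₂) (char0 : CharacteristicZero K)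
  (lam : HeytingField.Carrier K) (lam#0 : HeytingField._#_ K lam (HeytingField.0# K)) where

  open PowerSeries K char0

  -- Degenerate exponentials and their differential equations.

  μ : Carrier
  μ = 1/lam lam lam#0

  lam*μ≈1 : lam * μ ≈ 1#
  lam*μ≈1 = inv-inverseʳ lam lam#0

  e^ : Carrier → Series
  e^ = degExp^ lam lam#0

  e : Series
  e = degExp lam lam#0

  ℓ : ℕ → Series
  ℓ k = polylog lam lam#0 (+ k)

  e^₀≈1 : ∀ x → e^ x 0 ≈ 1#
  e^₀≈1 x = trans (*-identityʳ _) (trans (*-identityˡ _) 1/!0≈1)

  -- The new falling factor x/λ - n times the new factor λ is x - nλ, and n + 1 cancels against the
  -- factorial.
  D-e^ : ∀ x n → D (e^ x) n ≈ (x - ι n * lam) * e^ x n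
  D-e^ x n = begin
    ι (suc n) * (F * (y - ι n * 1#) * 1/! (suc n) * (lam * lam ^ n))
      ≈⟨ KSolver.solve 6 (λ s F z i l p → s :* (F :* z :* i :* (l :* p)) := (z :* l) :* (F :* (s :* i) :* p)) refl
           (ι (suc n)) F (y - ι n * 1#) (1/! (suc n)) lam (lam ^ n) ⟩
    (y - ι n * 1#) * lam * (F * (ι (suc n) * 1/! (suc n)) * lam ^ n)
      ≈⟨ *-cong factor (*-congʳ (*-congˡ (1/!-suc n))) ⟩
    (x - ι n * lam) * (F * 1/! n * lam ^ n)  ∎
    where
    open KReasoning
    open KSolver
    y = x * μ
    F = falling y n 1#
    factor : (y - ι n * 1#) * lam ≈ x - ι n * lam
    factor = begin
      (y - ι n * 1#) * lam        ≈⟨ [y-z]x≈yx-zx lam y (ι n * 1#) ⟩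
      x * μ * lam - ι n * 1# * lam
        ≈⟨ +-cong (KSolver.solve 3 (λ x m l → x :* m :* l := x :* (l :* m)) refl x μ lam)
                  (-‿cong (*-congʳ (*-identityʳ (ι n)))) ⟩
      x * (lam * μ) - ι n * lam
        ≈⟨ +-congʳ (trans (*-congˡ lam*μ≈1) (*-identityʳ x)) ⟩
      x - ι n * lam               ∎

  -- Both sides obey the same recurrence: differentiation moves the factor 1 - (n + 1)λ of `e` to
  -- index n, where it reads (1 - λ) - nλ.
  D-e : D e ≋ e^ (1# - lam)
  D-e = recurrence-unique (λ n → 1# - lam - ι n * lam)
    (trans D-e₀≈1 (sym (e^₀≈1 (1# - lam)))) D²-e (D-e^ (1# - lam))
    where
    open KReasoning
    D-e₀≈1 : D e 0 ≈ 1#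
    D-e₀≈1 = trans (*-cong ι1≈1 (degExp₁≈1 lam lam#0)) (*-identityˡ 1#)
    D²-e : ∀ n → D (D e) n ≈ (1# - lam - ι n * lam) * D e n
    D²-e n = begin
      ι (suc n) * D e (suc n)
        ≈⟨ *-congˡ (D-e^ 1# (suc n)) ⟩
      ι (suc n) * ((1# - ι (suc n) * lam) * e (suc n))
        ≈⟨ KSolver.solve 3 (λ s x y → s :* (x :* y) := x :* (s :* y)) refl (ι (suc n)) (1# - ι (suc n) * lam) (e (suc n)) ⟩
      (1# - ι (suc n) * lam) * D e n
        ≈⟨ *-congʳ shift ⟩
      (1# - lam - ι n * lam) * D e n  ∎
      where
      open KSolver
      shift : 1# - ι (suc n) * lam ≈ 1# - lam - ι n * lam
      shift = begin
        1# - (1# + ι n) * lam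
          ≈⟨ +-congˡ (-‿cong (trans (distribʳ lam 1# (ι n)) (+-congʳ (*-identityˡ lam)))) ⟩
        1# - (lam + ι n * lam)
          ≈⟨ +-congˡ (-‿+-comm lam (ι n * lam)) ⟨
        1# + (- lam - ι n * lam)
          ≈⟨ +-assoc _ _ _ ⟨
        1# - lam - ι n * lam  ∎

  -- The recurrence factor is zero at n = 0, so all later coefficients vanish. Hence the Bernoulli
  -- values at x = 0 come from t / (e_λ(t) - 1) alone.
  e^0≋1 : e^ 0# ≋ 1ˢ
  e^0≋1 = recurrence-unique (λ n → 0# - ι n * lam) (e^₀≈1 0#) (D-e^ 0#) λ
    { zero    → trans (zeroʳ _) (sym (trans (*-identityʳ _) (trans (+-congˡ (-‿cong (zeroˡ lam))) (x-0≈x 0#))))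
    ; (suc n) → trans (zeroʳ _) (sym (zeroʳ _)) }

  1+λt : Series
  1+λt = 1ˢ +ˢ delay (const lam)

  1+λt-*ˢ-suc : ∀ f n → (1+λt *ˢ f) (suc n) ≈ f (suc n) + lam * f n
  1+λt-*ˢ-suc f n = begin
    (1+λt *ˢ f) (suc n)
      ≈⟨ *ˢ-distribʳ f 1ˢ (delay (const lam)) (suc n) ⟩
    (1ˢ *ˢ f) (suc n) + (0# * f (suc n) + (const lam *ˢ f) n)
      ≈⟨ +-cong (*ˢ-identityˡ f (suc n)) (trans (+-congʳ (zeroˡ _)) (+-identityˡ _)) ⟩
    f (suc n) + (const lam *ˢ f) n
      ≈⟨ +-congˡ (const-*ˢ lam f n) ⟩
    f (suc n) + lam * f n  ∎
    where open KReasoning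

  1+λt-*ˢ-zero : ∀ f → (1+λt *ˢ f) 0 ≈ f 0
  1+λt-*ˢ-zero f = trans (+-identityʳ _) (trans (*-congʳ (+-identityʳ 1#)) (*-identityˡ _))

  -- The constant term of 1 + λt is 1, so the coefficients of f vanish one after another.
  1+λt-cancel : ∀ f → 1+λt *ˢ f ≋ 0ˢ → f ≋ 0ˢ
  1+λt-cancel f Lf≋0 zero    = trans (sym (1+λt-*ˢ-zero f)) (Lf≋0 0)
  1+λt-cancel f Lf≋0 (suc n) = begin
    f (suc n)               ≈⟨ +-identityʳ _ ⟨
    f (suc n) + 0#          ≈⟨ +-congˡ (trans (*-congˡ (1+λt-cancel f Lf≋0 n)) (zeroʳ lam)) ⟨
    f (suc n) + lam * f n   ≈⟨ 1+λt-*ˢ-suc f n ⟨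
    (1+λt *ˢ f) (suc n)     ≈⟨ Lf≋0 (suc n) ⟩
    0#                      ∎
    where open KReasoning

  -- As e_λ^x = (1 + λt)^(x/λ), it is an eigenvector of (1 + λt) d/dt with eigenvalue x. This trades
  -- the recurrence `D-e^`, whose factor depends on n, for an identity in the series ring.
  1+λt-D-e^ : ∀ x → 1+λt *ˢ D (e^ x) ≋ const x *ˢ e^ x
  1+λt-D-e^ x zero    = begin
    (1+λt *ˢ D (e^ x)) 0       ≈⟨ 1+λt-*ˢ-zero (D (e^ x)) ⟩
    D (e^ x) 0                 ≈⟨ D-e^ x 0 ⟩
    (x - 0# * lam) * e^ x 0    ≈⟨ *-congʳ (trans (+-congˡ (-‿cong (zeroˡ lam))) (x-0≈x x)) ⟩
    x * e^ x 0                 ≈⟨ const-*ˢ x (e^ x) 0 ⟨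
    (const x *ˢ e^ x) 0        ∎
    where open KReasoning
  1+λt-D-e^ x (suc n) = begin
    (1+λt *ˢ D (e^ x)) (suc n)
      ≈⟨ 1+λt-*ˢ-suc (D (e^ x)) n ⟩
    D (e^ x) (suc n) + lam * (ι (suc n) * E)
      ≈⟨ +-cong (D-e^ x (suc n))
           (KSolver.solve 3 (λ l i y → l :* (i :* y) := i :* l :* y) refl lam (ι (suc n)) E) ⟩
    (x - ι (suc n) * lam) * E + ι (suc n) * lam * E
      ≈⟨ distribʳ E (x - ι (suc n) * lam) (ι (suc n) * lam) ⟨
    (x - ι (suc n) * lam + ι (suc n) * lam) * E
      ≈⟨ *-congʳ (trans (+-assoc _ _ _) (trans (+-congˡ (-‿inverseˡ _)) (+-identityʳ x))) ⟩
    x * E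
      ≈⟨ const-*ˢ x (e^ x) (suc n) ⟨
    (const x *ˢ e^ x) (suc n)  ∎
    where
    open KReasoning
    open KSolver
    E = e^ x (suc n)

  -- Degenerate polylogarithms.

  delay-tail-ℓ : ∀ k → delay (tail (ℓ k)) ≋ ℓ k
  delay-tail-ℓ k zero    = refl
  delay-tail-ℓ k (suc n) = refl

  -- Here `tail (ℓ k)` is l_k(x)/x; differentiation cancels one of the k + 1 factors 1/(n + 1).
  D-ℓ : ∀ k → D (ℓ (suc k)) ≋ tail (ℓ k)
  D-ℓ k n = begin
    ι (suc n) * (P * (1/ι (suc n) * 1/ι (suc n) ^ k))
      ≈⟨ KSolver.solve 4 (λ s p i j → s :* (p :* (i :* j)) := (s :* i) :* (p :* j)) refl
           (ι (suc n)) P (1/ι (suc n)) (1/ι (suc n) ^ k) ⟩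
    ι (suc n) * 1/ι (suc n) * (P * 1/ι (suc n) ^ k)
      ≈⟨ trans (*-congʳ (1/ι-inverseʳ (suc n))) (*-identityˡ _) ⟩
    P * 1/ι (suc n) ^ k  ∎
    where
    open KReasoning
    open KSolver
    P = (- lam) ^ n * falling 1# (suc n) μ * 1/! n

  -- The binomial series (1 - x)^(λ - 1): coefficient n is (1 - λ)(2 - λ)...(n - λ)/n!.
  tail-ℓ₀ : Series
  tail-ℓ₀ = tail (ℓ 0)

  D-tail-ℓ₀ : ∀ n → D tail-ℓ₀ n ≈ (ι (suc n) - lam) * tail-ℓ₀ n
  D-tail-ℓ₀ n = begin
    ι (suc n) * (- lam * (- lam) ^ n * (F * (1# - ι (suc n) * μ)) * 1/! (suc n) * 1#)
      ≈⟨ KSolver.solve 7 (λ s l p F z i o → s :* (l :* p :* (F :* z) :* i :* o)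
                                        := (l :* z) :* (p :* F :* (s :* i) :* o)) refl
           (ι (suc n)) (- lam) ((- lam) ^ n) F (1# - ι (suc n) * μ) (1/! (suc n)) 1# ⟩
    - lam * (1# - ι (suc n) * μ) * ((- lam) ^ n * F * (ι (suc n) * 1/! (suc n)) * 1#)
      ≈⟨ *-cong factor (*-congʳ (*-congˡ (1/!-suc n))) ⟩
    (ι (suc n) - lam) * tail-ℓ₀ n  ∎
    where
    open KReasoning
    open KSolver
    F = falling 1# (suc n) μ
    factor : - lam * (1# - ι (suc n) * μ) ≈ ι (suc n) - lam
    factor = begin
      - lam * (1# - ι (suc n) * μ)             ≈⟨ distribˡ (- lam) 1# _ ⟩
      - lam * 1# + - lam * - (ι (suc n) * μ)   ≈⟨ +-cong (*-identityʳ _) (sym (-‿distribʳ-* (- lam) _)) ⟩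
      - lam + - (- lam * (ι (suc n) * μ))      ≈⟨ +-congˡ (-‿cong (-‿distribˡ-* lam _)) ⟨
      - lam + - - (lam * (ι (suc n) * μ))      ≈⟨ +-congˡ (-‿involutive _) ⟩
      - lam + lam * (ι (suc n) * μ)
        ≈⟨ +-congˡ (KSolver.solve 3 (λ l s m → l :* (s :* m) := s :* (l :* m)) refl lam (ι (suc n)) μ) ⟩
      - lam + ι (suc n) * (lam * μ)            ≈⟨ +-congˡ (trans (*-congˡ lam*μ≈1) (*-identityʳ _)) ⟩
      - lam + ι (suc n)                        ≈⟨ +-comm _ _ ⟩
      ι (suc n) - lam                          ∎

  -- This is (1 - x) F′ = (1 - λ) F with x F′ moved across, so that the right side is built from
  -- operations that commute with substitution. The summand n of the factor n + 1 - λ becomes x F′.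
  tail-ℓ₀-ode : D tail-ℓ₀ ≋ (const (1# - lam) *ˢ tail-ℓ₀) +ˢ delay (D tail-ℓ₀)
  tail-ℓ₀-ode n = begin
    D tail-ℓ₀ n                            ≈⟨ D-tail-ℓ₀ n ⟩
    (1# + ι n - lam) * f n
      ≈⟨ KSolver.solve 4 (λ o i l f → (o :+ i :+ l) :* f := (o :+ l) :* f :+ i :* f) refl 1# (ι n) (- lam) (f n) ⟩
    (1# - lam) * f n + ι n * f n           ≈⟨ +-cong (sym (const-*ˢ (1# - lam) f n)) (euler-delay n) ⟩
    (const (1# - lam) *ˢ f) n + delay (D f) n  ∎
    where
    open KReasoning
    open KSolver
    f = tail-ℓ₀
    euler-delay : ∀ n → ι n * f n ≈ delay (D f) n
    euler-delay zero    = zeroˡ _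
    euler-delay (suc n) = refl

  -- Substitution of u = 1 - e_λ(t).

  u : Series
  u = 1ˢ -ˢ e

  u₀≈0 : u 0 ≈ 0#
  u₀≈0 = trans (+-congˡ (-‿cong (e^₀≈1 1#))) (-‿inverseʳ 1#)

  ℓ/x∘u : ℕ → Series
  ℓ/x∘u k = substitute (tail (ℓ k)) u u₀≈0

  ε : Series
  ε = D e

  -- Stated as a vanishing sum, so that D u + ε can be factored out in subtraction-free
  -- rearrangements.
  D-u+ε≋0 : D u +ˢ ε ≋ 0ˢ
  D-u+ε≋0 n = begin
    ι (suc n) * (0# - e (suc n)) + ι (suc n) * e (suc n)  ≈⟨ distribˡ _ _ _ ⟨
    ι (suc n) * (0# - e (suc n) + e (suc n))
      ≈⟨ *-congˡ (trans (+-assoc _ _ _) (trans (+-identityˡ _) (-‿inverseˡ _))) ⟩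
    ι (suc n) * 0#                                        ≈⟨ zeroʳ _ ⟩
    0#                                                    ∎
    where open KReasoning

  D-u-*ˢ : ∀ f n → (D u *ˢ f) n ≈ - (ε *ˢ f) n
  D-u-*ˢ f n = +-inverseˡ-unique _ _ (begin
    (D u *ˢ f) n + (ε *ˢ f) n  ≈⟨ *ˢ-distribʳ f (D u) ε n ⟨
    ((D u +ˢ ε) *ˢ f) n        ≈⟨ *ˢ-congʳ {f} D-u+ε≋0 n ⟩
    (0ˢ *ˢ f) n                ≈⟨ *ˢ-zeroˡ f n ⟩
    0#                         ∎)
    where open KReasoning

  1+λt-ε : 1+λt *ˢ ε ≋ e
  1+λt-ε n = trans (1+λt-D-e^ 1# n) (trans (const-*ˢ 1# e n) (*-identityˡ _))

  1+λt-Dε : 1+λt *ˢ D ε ≋ const (1# - lam) *ˢ ε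
  1+λt-Dε = begin
    1+λt *ˢ D ε                          ≈⟨ *ˢ-congˡ {1+λt} (D-cong D-e) ⟩
    1+λt *ˢ D (e^ (1# - lam))            ≈⟨ 1+λt-D-e^ (1# - lam) ⟩
    const (1# - lam) *ˢ e^ (1# - lam)    ≈⟨ *ˢ-congˡ {const (1# - lam)} D-e ⟨
    const (1# - lam) *ˢ ε                ∎
    where open SReasoning

  -- Substituting u into `tail-ℓ₀-ode` gives Φ = (1 - λ) F(u) + u Φ. As e + u = 1, also Φ = e Φ + u
  -- Φ, and u Φ cancels.
  e*D-ℓ₀∘u : e *ˢ substitute (D tail-ℓ₀) u u₀≈0 ≋ const (1# - lam) *ˢ ℓ/x∘u 0
  e*D-ℓ₀∘u n = +-cancelʳ _ _ _ (pointwise n)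
    where
    open SReasoning
    Φ = substitute (D tail-ℓ₀) u u₀≈0
    k = const (1# - lam)
    e+u≋1 : e +ˢ u ≋ 1ˢ
    e+u≋1 n = trans (+-comm _ _) (trans (+-assoc _ _ _) (trans (+-congˡ (-‿inverseˡ _)) (+-identityʳ _)))
    pointwise : (e *ˢ Φ) +ˢ (u *ˢ Φ) ≋ (k *ˢ ℓ/x∘u 0) +ˢ (u *ˢ Φ)
    pointwise = begin
      (e *ˢ Φ) +ˢ (u *ˢ Φ)
        ≈⟨ *ˢ-distribʳ Φ e u ⟨
      (e +ˢ u) *ˢ Φ
        ≈⟨ *ˢ-congʳ {Φ} e+u≋1 ⟩
      1ˢ *ˢ Φ
        ≈⟨ *ˢ-identityˡ Φ ⟩
      Φ
        ≈⟨ ∘-cong u u₀≈0 tail-ℓ₀-ode ⟩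
      substitute ((k *ˢ tail-ℓ₀) +ˢ delay (D tail-ℓ₀)) u u₀≈0
        ≈⟨ ∘-+ u u₀≈0 (k *ˢ tail-ℓ₀) (delay (D tail-ℓ₀)) ⟩
      substitute (k *ˢ tail-ℓ₀) u u₀≈0 +ˢ substitute (delay (D tail-ℓ₀)) u u₀≈0
        ≈⟨ +ˢ-cong (∘-scale u u₀≈0 (1# - lam) tail-ℓ₀) (delay-∘ u u₀≈0 (D tail-ℓ₀)) ⟩
      (k *ˢ ℓ/x∘u 0) +ˢ (u *ˢ Φ)  ∎

  -- At 1 - x = e_λ the binomial series (1 - x)^(λ - 1) becomes e_λ^(λ - 1), the inverse of ε =
  -- e_λ^(1 - λ).
  ε*ℓ₀/x∘u≋1 : ε *ˢ ℓ/x∘u 0 ≋ 1ˢ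
  ε*ℓ₀/x∘u≋1 = D-injective constant-term
    (λ n → trans (1+λt-cancel (D (ε *ˢ F)) 1+λt-D n) (sym (zeroʳ (ι (suc n)))))
    where
    open SReasoning
    open SSolver
    F = ℓ/x∘u 0
    Φ = substitute (D tail-ℓ₀) u u₀≈0
    k = const (1# - lam)
    F₀≈1 : F 0 ≈ 1#
    F₀≈1 = trans (+-identityʳ _) (trans (*-identityʳ _) (trans (*-identityʳ _) (trans (*-cong
      (trans (*-identityˡ _) (trans (*-identityˡ _) (trans (+-congˡ (-‿cong (zeroˡ μ))) (x-0≈x 1#))))
      1/!0≈1) (*-identityˡ 1#))))
    constant-term : (ε *ˢ F) 0 ≈ 1#
    constant-term = trans (+-identityʳ _)
      (trans (*-cong (trans (D-e 0) (e^₀≈1 (1# - lam))) F₀≈1) (*-identityˡ 1#))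
    1+λt-D : 1+λt *ˢ D (ε *ˢ F) ≋ 0ˢ
    1+λt-D = begin
      1+λt *ˢ D (ε *ˢ F)
        ≈⟨ *ˢ-congˡ {1+λt} (≋-trans (D-*ˢ ε F) (+ˢ-congˡ {D ε *ˢ F} (*ˢ-congˡ {ε} (D-∘ u u₀≈0 tail-ℓ₀)))) ⟩
      1+λt *ˢ ((D ε *ˢ F) +ˢ (ε *ˢ (D u *ˢ Φ)))
        -- The factor 1 + λt goes to `D ε` in the first summand and to `ε` in the second, where it
        -- yields (1 - λ) ε and `e`.
        ≈⟨ SSolver.solve 6 (λ l a f b d p → l :* (a :* f :+ b :* (d :* p)) := (l :* a) :* f :+ d :* ((l :* b) :* p))
             ≋-refl 1+λt (D ε) F ε (D u) Φ ⟩
      ((1+λt *ˢ D ε) *ˢ F) +ˢ (D u *ˢ ((1+λt *ˢ ε) *ˢ Φ))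
        ≈⟨ +ˢ-cong (*ˢ-congʳ {F} 1+λt-Dε)
             (*ˢ-congˡ {D u} (≋-trans (*ˢ-congʳ {Φ} 1+λt-ε) e*D-ℓ₀∘u)) ⟩
      ((k *ˢ ε) *ˢ F) +ˢ (D u *ˢ (k *ˢ F))
        ≈⟨ SSolver.solve 4 (λ k b f d → k :* b :* f :+ d :* (k :* f) := (d :+ b) :* (k :* f)) ≋-refl k ε F (D u) ⟩
      (D u +ˢ ε) *ˢ (k *ˢ F)
        ≈⟨ *ˢ-congʳ {k *ˢ F} D-u+ε≋0 ⟩
      0ˢ *ˢ (k *ˢ F)
        ≈⟨ *ˢ-zeroˡ (k *ˢ F) ⟩
      0ˢ  ∎

  -- Division by e_λ(t) - 1 and the Bernoulli generating function.

  [e-1]/t : Series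
  [e-1]/t = divideByT (e -ˢ 1ˢ) (degExp-1₀≈0 lam lam#0)

  t/[e-1] : Series
  t/[e-1] = t/ (e -ˢ 1ˢ) (degExp-1₀≈0 lam lam#0) (degExp-1₁#0 lam lam#0)

  [e-1]/t*t/[e-1]≋1 : [e-1]/t *ˢ t/[e-1] ≋ 1ˢ
  [e-1]/t*t/[e-1]≋1 = *ˢ-recip [e-1]/t (degExp-1₁#0 lam lam#0)

  -- u is -t times `[e-1]/t`, so the factor t shifts the index by one and the sign comes out.
  u-*ˢ-suc : ∀ f n → (u *ˢ f) (suc n) ≈ - ([e-1]/t *ˢ f) n
  u-*ˢ-suc f n = trans (trans (+-congʳ (trans (*-congʳ u₀≈0) (zeroˡ _))) (+-identityˡ _))
    (+-inverseˡ-unique _ _ (begin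
      (tail u *ˢ f) n + ([e-1]/t *ˢ f) n  ≈⟨ *ˢ-distribʳ f (tail u) [e-1]/t n ⟨
      ((tail u +ˢ [e-1]/t) *ˢ f) n        ≈⟨ *ˢ-congʳ {f} opposite n ⟩
      (0ˢ *ˢ f) n                       ≈⟨ *ˢ-zeroˡ f n ⟩
      0#                                ∎))
    where
    open KReasoning
    opposite : tail u +ˢ [e-1]/t ≋ 0ˢ
    opposite n = trans (+-cong (+-identityˡ _) (x-0≈x _)) (-‿inverseˡ _)

  D-u*ℓ/x∘u : ∀ k → D (u *ˢ ℓ/x∘u (suc k)) ≋ D u *ˢ ℓ/x∘u k
  D-u*ℓ/x∘u k = begin
    D (u *ˢ ℓ/x∘u (suc k))
      ≈⟨ D-cong (≋-trans (≋-sym (delay-∘ u u₀≈0 (tail (ℓ (suc k))))) (∘-cong u u₀≈0 (delay-tail-ℓ (suc k)))) ⟩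
    D (substitute (ℓ (suc k)) u u₀≈0)
      ≈⟨ D-∘ u u₀≈0 (ℓ (suc k)) ⟩
    D u *ˢ substitute (D (ℓ (suc k))) u u₀≈0
      ≈⟨ *ˢ-congˡ {D u} (∘-cong u u₀≈0 (D-ℓ k)) ⟩
    D u *ˢ ℓ/x∘u k  ∎
    where open SReasoning

  -- The recursion in k, used at k = 0 and k = 1. Coefficient n of `D (u *ˢ ℓ/x∘u (suc k))` is minus
  -- the left side; this sign, from u, cancels the one from D u = - ε.
  ℓ/x∘u-suc : ∀ k n → ι (suc n) * ([e-1]/t *ˢ ℓ/x∘u (suc k)) n ≈ (ε *ˢ ℓ/x∘u k) n
  ℓ/x∘u-suc k n = -‿injective (begin
    - (ι (suc n) * ([e-1]/t *ˢ ℓ/x∘u (suc k)) n)  ≈⟨ -‿distribʳ-* _ _ ⟩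
    ι (suc n) * - ([e-1]/t *ˢ ℓ/x∘u (suc k)) n    ≈⟨ *-congˡ (u-*ˢ-suc (ℓ/x∘u (suc k)) n) ⟨
    D (u *ˢ ℓ/x∘u (suc k)) n                    ≈⟨ D-u*ℓ/x∘u k n ⟩
    (D u *ˢ ℓ/x∘u k) n                          ≈⟨ D-u-*ˢ (ℓ/x∘u k) n ⟩
    - (ε *ˢ ℓ/x∘u k) n                          ∎)
    where open KReasoning

  divide : ∀ {f g} → [e-1]/t *ˢ f ≋ g → f ≋ t/[e-1] *ˢ g
  divide {f} {g} p = begin
    f                          ≈⟨ *ˢ-identityˡ f ⟨
    1ˢ *ˢ f                    ≈⟨ *ˢ-congʳ {f} [e-1]/t*t/[e-1]≋1 ⟨
    [e-1]/t *ˢ t/[e-1] *ˢ f        ≈⟨ SSolver.solve 3 (λ a b f → a :* b :* f := b :* (a :* f)) ≋-refl [e-1]/t t/[e-1] f ⟩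
    t/[e-1] *ˢ ([e-1]/t *ˢ f)      ≈⟨ *ˢ-congˡ {t/[e-1]} p ⟩
    t/[e-1] *ˢ g                 ∎
    where
    open SReasoning
    open SSolver

  ℓ₁/x∘u≋t/[e-1] : ℓ/x∘u 1 ≋ t/[e-1]
  ℓ₁/x∘u≋t/[e-1] = ≋-trans (divide λ n → ι-cancelˡ (suc n) (begin
    ι (suc n) * ([e-1]/t *ˢ ℓ/x∘u 1) n  ≈⟨ ℓ/x∘u-suc 0 n ⟩
    (ε *ˢ ℓ/x∘u 0) n                  ≈⟨ ε*ℓ₀/x∘u≋1 n ⟩
    -- The factor n + 1 is 1 at n = 0 and meets a zero coefficient elsewhere, so `1ˢ` absorbs it.
    1ˢ n                              ≈⟨ ι*1ˢ n ⟨
    ι (suc n) * 1ˢ n                  ∎))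
    (*ˢ-identityʳ t/[e-1])
    where
    open KReasoning
    ι*1ˢ : ∀ n → ι (suc n) * 1ˢ n ≈ 1ˢ n
    ι*1ˢ zero    = trans (*-identityʳ _) ι1≈1
    ι*1ˢ (suc n) = zeroʳ _

  -- (1/t) ∫₀ᵗ s e_λ^{1-λ}(s) / (e_λ(s) - 1) ds
  meanB : Series
  meanB n = (t/[e-1] *ˢ e^ (1# - lam)) n * 1/ι (suc n)

  -- The recursion at k = 1 has right side t e_λ^(1-λ) / (e_λ - 1) by the previous case; dividing
  -- its coefficients by n + 1 gives `meanB`.
  ℓ₂/x∘u : ℓ/x∘u 2 ≋ t/[e-1] *ˢ meanB
  ℓ₂/x∘u = divide λ n → *-1/ι (suc n) (begin
    ι (suc n) * ([e-1]/t *ˢ ℓ/x∘u 2) n  ≈⟨ ℓ/x∘u-suc 1 n ⟩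
    (ε *ˢ ℓ/x∘u 1) n                  ≈⟨ *ˢ-cong D-e ℓ₁/x∘u≋t/[e-1] n ⟩
    (e^ (1# - lam) *ˢ t/[e-1]) n        ≈⟨ *ˢ-comm (e^ (1# - lam)) t/[e-1] n ⟩
    (t/[e-1] *ˢ e^ (1# - lam)) n        ∎)
    where open KReasoning

  -- Signs and binomial convolution.

  1-e[-t]≋u[-t] : 1ˢ -ˢ e [-t] ≋ u [-t]
  1-e[-t]≋u[-t] n = sym (trans (x[y-z]≈xy-xz _ _ _) (+-congʳ (1ˢ[-t] n)))

  egfCoeff-poly : ∀ n → polyBernoulli lam lam#0 (+ 2) n ≈ (- 1#) ^ n * egfCoeff (t/[e-1] *ˢ meanB) n
  egfCoeff-poly n = begin
    ι (n !) * substitute (tail (ℓ 2)) (1ˢ -ˢ e [-t]) (1-degExp[-t]₀≈0 lam lam#0) n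
      ≈⟨ *-congˡ (substitute-[-t] (tail (ℓ 2)) u u₀≈0 (1ˢ -ˢ e [-t]) (1-degExp[-t]₀≈0 lam lam#0) 1-e[-t]≋u[-t] n) ⟩
    ι (n !) * ((- 1#) ^ n * ℓ/x∘u 2 n)
      ≈⟨ KSolver.solve 3 (λ a s x → a :* (s :* x) := s :* (a :* x)) refl (ι (n !)) ((- 1#) ^ n) (ℓ/x∘u 2 n) ⟩
    (- 1#) ^ n * (ι (n !) * ℓ/x∘u 2 n)
      ≈⟨ *-congˡ (*-congˡ (ℓ₂/x∘u n)) ⟩
    (- 1#) ^ n * egfCoeff (t/[e-1] *ˢ meanB) n  ∎
    where
    open KReasoning
    open KSolver

  β : ℕ → Carrier
  β n = bernoulli lam lam#0 n 0#

  β′ : ℕ → Carrier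
  β′ n = bernoulli lam lam#0 n (1# - lam)

  β≈egfCoeff : ∀ n → β n ≈ egfCoeff t/[e-1] n
  β≈egfCoeff n = *-congˡ (trans (*ˢ-congˡ {t/[e-1]} e^0≋1 n) (*ˢ-identityʳ t/[e-1] n))

  -- The factor 1/(n + 1) left by integration in `meanB` is the source of the denominators n - m + 1
  -- and m + 1 in the two sums.
  β′≈egfCoeff : ∀ n → β′ n * 1/ι (suc n) ≈ egfCoeff meanB n
  β′≈egfCoeff n = *-assoc _ _ _

  egfCoeff-product : ∀ n → egfCoeff (t/[e-1] *ˢ meanB) n ≈
    ∑[ m ≤ n ] (ι (n C toℕ m) * β (toℕ m) * (β′ (n ∸ toℕ m) * 1/ι (suc (n ∸ toℕ m))))
  egfCoeff-product n = trans (egfCoeff-*ˢ t/[e-1] meanB n)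
    (sum-cong-≋ {suc n} λ m → trans
      (*-congˡ {ι (n C toℕ m)} (sym (*-cong (β≈egfCoeff (toℕ m)) (β′≈egfCoeff (n ∸ toℕ m)))))
      (sym (*-assoc _ _ _)))

  -- Convolving the two factors in the opposite order gives the second sum directly, without
  -- reindexing m to n - m or the symmetry of binomial coefficients.
  egfCoeff-product-flipped : ∀ n → egfCoeff (t/[e-1] *ˢ meanB) n ≈
    ∑[ m ≤ n ] (ι (n C toℕ m) * β (n ∸ toℕ m) * (β′ (toℕ m) * 1/ι (suc (toℕ m))))
  egfCoeff-product-flipped n = begin
    egfCoeff (t/[e-1] *ˢ meanB) n
      ≈⟨ *-congˡ (*ˢ-comm t/[e-1] meanB n) ⟩
    egfCoeff (meanB *ˢ t/[e-1]) n
      ≈⟨ egfCoeff-*ˢ meanB t/[e-1] n ⟩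
    (∑[ m ≤ n ] (ι (n C toℕ m) * (egfCoeff meanB (toℕ m) * egfCoeff t/[e-1] (n ∸ toℕ m))))
      ≈⟨ sum-cong-≋ {suc n} (λ m → term (toℕ m)) ⟩
    (∑[ m ≤ n ] (ι (n C toℕ m) * β (n ∸ toℕ m) * (β′ (toℕ m) * 1/ι (suc (toℕ m)))))  ∎
    where
    open KReasoning
    term : ∀ m → ι (n C m) * (egfCoeff meanB m * egfCoeff t/[e-1] (n ∸ m))
               ≈ ι (n C m) * β (n ∸ m) * (β′ m * 1/ι (suc m))
    term m = begin
      ι (n C m) * (egfCoeff meanB m * egfCoeff t/[e-1] (n ∸ m))
        ≈⟨ *-congˡ (*-cong (β′≈egfCoeff m) (β≈egfCoeff (n ∸ m))) ⟨
      ι (n C m) * (β′ m * 1/ι (suc m) * β (n ∸ m))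
        ≈⟨ *-congˡ (*-comm _ _) ⟩
      ι (n C m) * (β (n ∸ m) * (β′ m * 1/ι (suc m)))
        ≈⟨ *-assoc _ _ _ ⟨
      ι (n C m) * β (n ∸ m) * (β′ m * 1/ι (suc m))  ∎

theorem5 :
    ∀ {c ℓ₁ ℓ₂} (K : HeytingField c ℓ₁ ℓ₂) (char0 : CharacteristicZero K) →
    let open HeytingFieldOps K
        open Degenerate K char0
    in
    (lam : Carrier) (lam#0 : lam # 0#) →
    let β  = λ n → bernoulli lam lam#0 n 0#
        β′ = λ n → bernoulli lam lam#0 n (1# - lam)
    in
    (n : ℕ) →
    (polyBernoulli lam lam#0 (+ 2) n
       ≈ (- 1#) ^ n * (∑[ m ≤ n ] (ι (n C toℕ m) * β (toℕ m)
                                     * (β′ (n ∸ toℕ m) * 1/ι (suc (n ∸ toℕ m))))))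
    ×
    ((- 1#) ^ n * (∑[ m ≤ n ] (ι (n C toℕ m) * β (toℕ m)
                                 * (β′ (n ∸ toℕ m) * 1/ι (suc (n ∸ toℕ m)))))
       ≈ (- 1#) ^ n * (∑[ m ≤ n ] (ι (n C toℕ m) * β (n ∸ toℕ m)
                                     * (β′ (toℕ m) * 1/ι (suc (toℕ m))))))
theorem5 K char0 lam lam#0 n =
    trans (egfCoeff-poly n) (*-congˡ (egfCoeff-product n))
  , *-congˡ (trans (sym (egfCoeff-product n)) (egfCoeff-product-flipped n))
  where
  open PowerSeries K char0
  open PolyBernoulli K char0 lam lam#0
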